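{- For every commutative $\mathbb{Q}$-algebra $R$ with unit and all $\lambda,\mu,\nu\in R$ there are bijections \[\operatorname{BM}(R)\simeq\operatorname{Hom}_{\mathbb{Q}\text{ -alg}}(\mathcal{G}^{\operatorname{f}},R),\qquad \operatorname{BM}_{(\lambda,\mu,\nu)}(R)\simeq \operatorname{Hom}_{\mathbb{Q}\text{ -alg}}\big(\mathcal{G}^{\operatorname{f}}/(\operatorname{f}(b_2)-\lambda,\operatorname{f}(b_4)-\mu,\operatorname{f}(b_6)-\nu),R\big),\] the first being given by $\varphi\mapsto\sum_{w\in\mathcal{B}^*}\varphi(\operatorname{f}(w))\,w$ (with inverse $\Phi\mapsto(\operatorname{f}(w)\mapsto(\Phi\mid w))$). In particular, $\operatorname{BM}$ is an affine scheme on commutative $\mathbb{Q}$-algebras represented by $\mathcal{G}^{\operatorname{f}}$, and $\operatorname{BM}_{(\lambda,\mu,\nu)}$ is an affine scheme represented by $\mathcal{G}^{\operatorname{f}}/(\operatorname{f}(b_2)-\lambda,\operatorname{f}(b_4)-\mu,\operatorname{f}(b_6)-\nu)$.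
   Context: Let $\mathcal{B}=\{b_0,b_1,b_2,\ldots\}$, $\mathcal{B}^*$ the set of words (empty word $\mathbf{1}$), $\mathbb{Q}\langle\mathcal{B}\rangle$ the free non-commutative polynomial algebra and $R\langle\langle\mathcal{B}\rangle\rangle$ the non-commutative power series with coefficients in $R$; $(\Phi\mid w)$ is the coefficient of the word $w$ in $\Phi$. The balanced quasi-shuffle product $\ast_b$ on $\mathbb{Q}\langle\mathcal{B}\rangle$: $\mathbf{1}\ast_b w=w\ast_b\mathbf{1}=w$, $b_iu\ast_b b_jv=b_i(u\ast_b b_jv)+b_j(b_iu\ast_b v)+\delta\,b_{i+j}(u\ast_b v)$ with $\delta=1$ if $i,j\geq1$ and $\delta=0$ otherwise. Let $\mathbb{Q}\langle\mathcal{B}\rangle^0$ be the span of words not starting with $b_0$, and $\tau:\mathbb{Q}\langle\mathcal{B}\rangle^0\to\mathbb{Q}\langle\mathcal{B}\rangle^0$ the $\mathbb{Q}$-linear involution $\tau(b_{k_1}b_0^{m_1}\cdots b_{k_d}b_0^{m_d})=b_{m_d+1}b_0^{k_d-1}\cdots b_{m_1+1}b_0^{k_1-1}$ ($k_i\geq1,m_i\geq0$), extended $R$-linearly and coefficientwise to power series. Define $\mathcal{G}^{\operatorname{f}}=(\mathbb{Q}\langle\mathcal{B}\rangle,\ast_b)/\operatorname{Rel}_{\tau,0}$, where $\operatorname{Rel}_{\tau,0}$ is the ideal (for $\ast_b$) generated by $b_0$ and all $w-\tau(w)$, $w\in\mathbb{Q}\langle\mathcal{B}\rangle^0$; $\operatorname{f}(w)$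 denotes the class of $w$. The coproduct $\Delta_b$ on $R\langle\langle\mathcal{B}\rangle\rangle$ is the concatenation-multiplicative continuous map with $\Delta_b(b_i)=\mathbf{1}\otimes b_i+b_i\otimes\mathbf{1}+\sum_{j=1}^{i-1}b_j\otimes b_{i-j}$. $\Pi_0$ is the $R$-linear projection onto power series supported on words not starting with $b_0$ (identity on such words, $0$ on words starting with $b_0$). $\operatorname{BM}(R)$ is the set of $\Phi\in R\langle\langle\mathcal{B}\rangle\rangle$ with (i) $(\Phi\mid b_0)=0$, (ii) $\Delta_b(\Phi)=\Phi\otimes\Phi$, (iii) $\tau(\Pi_0(\Phi))=\Pi_0(\Phi)$; and $\operatorname{BM}_{(\lambda,\mu,\nu)}(R)$ is the subset with additionally $(\Phi\mid b_2)=\lambda$, $(\Phi\mid b_4)=\mu$, $(\Phi\mid b_6)=\nu$. -}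

module Defs where

open import Level using (Level; _⊔_)
open import Data.Nat as ℕ using (ℕ; zero; suc; _≡ᵇ_; _∸_)
open import Data.Bool using (Bool; true; false; if_then_else_)
open import Data.List using (List; []; _∷_; _++_; map; concatMap; upTo; reverse; replicate; length; foldr)
open import Data.Nat.ListAction using (sum)
open import Data.Product using (_×_; _,_; Σ)
open import Data.Rational using (ℚ)
open import Data.Rational.Properties using (+-*-commutativeRing)
open import Algebra.Bundles using (CommutativeRing)
open import Algebra.Morphism.Structures using (module RingMorphisms)
open import Relation.Binary.PropositionalEquality using (_≢_)

record QAlgebra (c ℓ : Level) : Set (Level.suc (c ⊔ ℓ)) where
  field
    commRing : CommutativeRing c ℓ
  open CommutativeRing commRing public
  field
    ι     : ℚ → Carrier
    ι-hom : RingMorphisms.IsRingHomomorphism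
              (CommutativeRing.rawRing +-*-commutativeRing) rawRing ι

-- Words over B = {b₀, b₁, …}: the letter b_i is represented by i.

Word : Set
Word = List ℕ

NotStartingWithb₀ : Word → Set
NotStartingWithb₀ []      = Data.Bool.T true
NotStartingWithb₀ (k ∷ _) = k ≢ 0

-- The balanced quasi-shuffle product of two words, as a polynomial with
-- ℕ-coefficients represented by the list of its words with multiplicity.

private
  δ-term : ℕ → ℕ → List Word → List Word
  δ-term (suc a) (suc b) ws = map ((suc a ℕ.+ suc b) ∷_) ws
  δ-term _       _       ws = []

_∗b_ : Word → Word → List Word
[]      ∗b v       = v ∷ []
(i ∷ u) ∗b []      = (i ∷ u) ∷ []
(i ∷ u) ∗b (j ∷ v) =
  map (i ∷_) (u ∗b (j ∷ v)) ++ map (j ∷_) ((i ∷ u) ∗b v) ++ δ-term i j (u ∗b v)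

-- A word b_{k₁} b₀^{m₁} ⋯ b_{k_d} b₀^{m_d} is decomposed into its blocks
-- (k₁,m₁) … (k_d,m_d); the fold also returns the number of leading b₀'s
-- (which is 0 for words in Q⟨B⟩⁰).

blocks : Word → ℕ × List (ℕ × ℕ)
blocks = foldr step (0 , [])
  where
  step : ℕ → ℕ × List (ℕ × ℕ) → ℕ × List (ℕ × ℕ)
  step zero    (z , bs) = (suc z , bs)
  step (suc k) (z , bs) = (0 , (suc k , z) ∷ bs)

τ : Word → Word
τ w with blocks w
... | (_ , bs) = concatMap (λ { (k , m) → suc m ∷ replicate (k ∸ 1) 0 }) (reverse bs)

-- Coefficients of the coproduct Δ_b:  Δcoef w u v = (Δ_b(w) ∣ u ⊗ v),
-- computed from Δ_b(b_i w') = Δ_b(b_i) Δ_b(w') with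
-- Δ_b(b_i) = 1⊗b_i + b_i⊗1 + Σ_{j=1}^{i-1} b_j ⊗ b_{i-j}.

private
  [_] : Bool → ℕ
  [ true ]  = 1
  [ false ] = 0

Δcoef : Word → Word → Word → ℕ
Δcoef []      []      []      = 1
Δcoef []      _       _       = 0
Δcoef (i ∷ w) u v = left u v ℕ.+ right u v ℕ.+ mid u v
  where
  left : Word → Word → ℕ
  left u' []        = 0
  left u' (j ∷ v')  = [ i ≡ᵇ j ] ℕ.* Δcoef w u' v'
  right : Word → Word → ℕ
  right []       v' = 0
  right (j ∷ u') v' = [ i ≡ᵇ j ] ℕ.* Δcoef w u' v'
  -- terms b_j ⊗ b_{i-j}, 1 ≤ j ≤ i-1
  mid : Word → Word → ℕ
  mid (suc a ∷ u') (suc b ∷ v') = [ i ≡ᵇ (suc a ℕ.+ suc b) ] ℕ.* Δcoef w u' v'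
  mid _            _            = 0

wordsOfLength : ℕ → ℕ → List Word
wordsOfLength zero    N = [] ∷ []
wordsOfLength (suc L) N = concatMap (λ i → map (i ∷_) (wordsOfLength L N)) (upTo (suc N))

wordsUpTo : ℕ → ℕ → List Word
wordsUpTo L N = concatMap (λ l → wordsOfLength l N) (upTo (suc L))

wt : Word → ℕ
wt = sum

-- Every word w with (Δ_b(w) ∣ u ⊗ v) ≠ 0 has length ≤ |u|+|v| and letters
-- b_i with i ≤ wt u + wt v; hence the (formally infinite) sum defining
-- (Δ_b(Φ) ∣ u ⊗ v) = Σ_w (Φ ∣ w)(Δ_b(w) ∣ u ⊗ v) is the finite sum over:
supportΔ : Word → Word → List Word
supportΔ u v = wordsUpTo (length u ℕ.+ length v) (wt u ℕ.+ wt v)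

module _ {c ℓ : Level} (R : QAlgebra c ℓ) where
  open QAlgebra R

  _·ₙ_ : ℕ → Carrier → Carrier
  zero  ·ₙ x = 0#
  suc n ·ₙ x = x + (n ·ₙ x)

  Σᴿ : List Carrier → Carrier
  Σᴿ = foldr _+_ 0#

  -- Power series in R⟨⟨B⟩⟩ : functions Word → R  (w ↦ (Φ ∣ w)).
  Series : Set c
  Series = Word → Carrier

  ΔbCoeff : Series → Word → Word → Carrier
  ΔbCoeff Φ u v = Σᴿ (map (λ w → Δcoef w u v ·ₙ Φ w) (supportΔ u v))

  -- Group-likeness Δ_b(Φ) = Φ ⊗ Φ is taken with the usual
  -- normalisation (Φ ∣ 1) = 1 of group-like elements.
  -- Condition (iii) τ(Π₀ Φ) = Π₀ Φ, read coefficientwise: at words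
  -- starting with b₀ both sides vanish; at w ∈ Q⟨B⟩⁰ the coefficient of
  -- τ(Π₀Φ) is (Φ ∣ τ⁻¹ w) = (Φ ∣ τ w) since τ is an involution.
  record IsBM (Φ : Series) : Set (c ⊔ ℓ) where
    field
      unit     : Φ [] ≈ 1#
      b₀-zero  : Φ (0 ∷ []) ≈ 0#
      grouplike : ∀ u v → ΔbCoeff Φ u v ≈ Φ u * Φ v
      τ-inv    : ∀ w → NotStartingWithb₀ w → Φ (τ w) ≈ Φ w

  record IsBMλμν (λ' μ ν : Carrier) (Φ : Series) : Set (c ⊔ ℓ) where
    field
      isBM : IsBM Φ
      b₂   : Φ (2 ∷ []) ≈ λ'
      b₄   : Φ (4 ∷ []) ≈ μ
      b₆   : Φ (6 ∷ []) ≈ ν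

  -- A ℚ-linear map Q⟨B⟩ → R is given by
  -- its values φ w = φ(f(w)) on the word basis; it is a homomorphism of
  -- ℚ-algebras (Q⟨B⟩,∗_b) → R iff it is unital and multiplicative on basis
  -- words, and it factors through the quotient G^f = Q⟨B⟩/Rel_{τ,0} iff it
  -- vanishes on the generators b₀ and w − τ(w) (w ∈ Q⟨B⟩⁰) of the ideal.
  record IsHomGf (φ : Word → Carrier) : Set (c ⊔ ℓ) where
    field
      unit    : φ [] ≈ 1#
      mult    : ∀ u v → Σᴿ (map φ (u ∗b v)) ≈ φ u * φ v
      b₀-zero : φ (0 ∷ []) ≈ 0#
      τ-inv   : ∀ w → NotStartingWithb₀ w → φ w ≈ φ (τ w)

  -- ℚ-algebra homomorphisms G^f/(f(b₂)−λ, f(b₄)−μ, f(b₆)−ν) → R, i.e.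
  -- homomorphisms G^f → R sending f(b₂), f(b₄), f(b₆) to λ, μ, ν.
  record IsHomGfλμν (λ' μ ν : Carrier) (φ : Word → Carrier) : Set (c ⊔ ℓ) where
    field
      isHom : IsHomGf φ
      b₂    : φ (2 ∷ []) ≈ λ'
      b₄    : φ (4 ∷ []) ≈ μ
      b₆    : φ (6 ∷ []) ≈ ν

-- Apart from group-likeness, the conditions defining BM and Hom(G^f, R) coincide, so
-- everything rests on the duality between Δ_b and ∗b: the coefficient (Δ_b(w) ∣ u ⊗ v)
-- is the multiplicity of w in u ∗b v, as both satisfy the same recursion in the first
-- letters of u and v.  The finite sum computing (Δ_b(Φ) ∣ u ⊗ v) runs over the words of
-- length ≤ |u| + |v| with letters ≤ wt u + wt v, each listed once; ∗b preserves weight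
-- and does not increase length, so every word of u ∗b v occurs there exactly once and
-- (Δ_b(Φ) ∣ u ⊗ v) = Σ_{x ∈ u ∗b v} (Φ ∣ x).  Group-likeness of Φ is thus exactly
-- multiplicativity of w ↦ (Φ ∣ w) for ∗b.

module Submission where

open import Defs
open import Level using (Level)
open import Data.Product using (_×_; _,_)
open import Function.Bundles using (_⇔_; mk⇔; Equivalence)
open import Function.Base using (_∘_)
open import Data.Bool.Base using (Bool; true; false; _∧_)
open import Data.Nat.Base as ℕ using (ℕ; zero; suc)
open import Data.List.Base using (List; []; _∷_; _++_; map; concatMap; upTo; length)
open import Data.List.Properties using (map-cong)
open import Data.List.Relation.Unary.All as All using (All; []; _∷_)
open import Relation.Nullary.Decidable using (yes; no; does; dec-true; dec-false)
open import Relation.Binary.Definitions using (DecidableEquality)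
import Relation.Binary.PropositionalEquality as ≡
open ≡ using (_≡_; _≢_)

module Counting where
  open import Data.Nat.Base using (_+_; _*_; _≤_; _<_)
  open import Data.Nat.Properties
  open import Data.Nat.ListAction using (sum)
  open import Data.Nat.ListAction.Properties using (sum-++)
  open import Data.List.Base using ([_])
  open import Data.List.Properties using (map-++; upTo-∷ʳ)
  open import Data.List.Relation.Unary.All.Properties using (all-upTo)
  open import Data.Sum.Base using (inj₁; inj₂)
  open ≡ using (refl; sym; trans; cong; cong₂; module ≡-Reasoning)

  ⟦_⟧ : Bool → ℕ
  ⟦ true ⟧  = 1
  ⟦ false ⟧ = 0

  ⟦∧⟧ : ∀ b c → ⟦ b ∧ c ⟧ ≡ ⟦ b ⟧ * ⟦ c ⟧
  ⟦∧⟧ true  c = sym (+-identityʳ ⟦ c ⟧)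
  ⟦∧⟧ false c = refl

  sum-map-zero : ∀ {A : Set} {f : A → ℕ} {xs} → All (λ x → f x ≡ 0) xs → sum (map f xs) ≡ 0
  sum-map-zero []            = refl
  sum-map-zero (fx≡0 ∷ rest) = cong₂ _+_ fx≡0 (sum-map-zero rest)

  sum-upTo-suc : ∀ (f : ℕ → ℕ) n → sum (map f (upTo (suc n))) ≡ sum (map f (upTo n)) + f n
  sum-upTo-suc f n = begin
    sum (map f (upTo (suc n)))        ≡⟨ cong (sum ∘ map f) (upTo-∷ʳ n) ⟨
    sum (map f (upTo n ++ [ n ]))     ≡⟨ cong sum (map-++ f (upTo n) [ n ]) ⟩
    sum (map f (upTo n) ++ [ f n ])   ≡⟨ sum-++ (map f (upTo n)) [ f n ] ⟩
    sum (map f (upTo n)) + (f n + 0)  ≡⟨ cong (sum (map f (upTo n)) +_) (+-identityʳ (f n)) ⟩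
    sum (map f (upTo n)) + f n        ∎
    where open ≡-Reasoning

  sum-upTo-single : ∀ (f : ℕ → ℕ) {m n} → m < n → (∀ l → l ≢ m → f l ≡ 0) →
                    sum (map f (upTo n)) ≡ f m
  sum-upTo-single f {m} {suc n} m<1+n vanishes with m<1+n⇒m<n∨m≡n m<1+n
  ... | inj₁ m<n  = trans (sum-upTo-suc f n)
    (trans (cong₂ _+_ (sum-upTo-single f m<n vanishes) (vanishes n (>⇒≢ m<n))) (+-identityʳ (f m)))
  ... | inj₂ refl = trans (sum-upTo-suc f n)
    (cong (_+ f n) (sum-map-zero (All.map (λ {l} l<n → vanishes l (<⇒≢ l<n)) (all-upTo n))))

  All-≤-sum : ∀ ns → All (_≤ sum ns) ns
  All-≤-sum []       = []
  All-≤-sum (n ∷ ns) =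
    m≤m+n n (sum ns) ∷ All.map (λ k≤ → ≤-trans k≤ (m≤n+m (sum ns) n)) (All-≤-sum ns)

  module Multiplicity {a} {A : Set a} (_≟_ : DecidableEquality A) where

    multiplicity : A → List A → ℕ
    multiplicity x []       = 0
    multiplicity x (y ∷ ys) = ⟦ does (x ≟ y) ⟧ + multiplicity x ys

    multiplicity-++ : ∀ x ys zs → multiplicity x (ys ++ zs) ≡ multiplicity x ys + multiplicity x zs
    multiplicity-++ x []       zs = refl
    multiplicity-++ x (y ∷ ys) zs =
      trans (cong (⟦ does (x ≟ y) ⟧ +_) (multiplicity-++ x ys zs))
            (sym (+-assoc ⟦ does (x ≟ y) ⟧ (multiplicity x ys) (multiplicity x zs)))

    multiplicity-concatMap : ∀ {b} {B : Set b} x (f : B → List A) ys →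
                             multiplicity x (concatMap f ys) ≡ sum (map (multiplicity x ∘ f) ys)
    multiplicity-concatMap x f []       = refl
    multiplicity-concatMap x f (y ∷ ys) =
      trans (multiplicity-++ x (f y) (concatMap f ys))
            (cong (multiplicity x (f y) +_) (multiplicity-concatMap x f ys))

open Counting

module FiniteSums {c ℓ : Level} (R : QAlgebra c ℓ) where
  open QAlgebra R
  open import Relation.Binary.Reasoning.Setoid setoid
  open import Algebra.Properties.CommutativeSemigroup +-commutativeSemigroup using (interchange)

  infix 8 _·_
  _·_ : ℕ → Carrier → Carrier
  _·_ = _·ₙ_ R

  ∑ : List Carrier → Carrier
  ∑ = Σᴿ R

  ·-distribʳ-+ : ∀ m n x → (m ℕ.+ n) · x ≈ m · x + n · x
  ·-distribʳ-+ zero    n x = sym (+-identityˡ (n · x))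
  ·-distribʳ-+ (suc m) n x = begin
    x + (m ℕ.+ n) · x     ≈⟨ +-congˡ (·-distribʳ-+ m n x) ⟩
    x + (m · x + n · x)   ≈⟨ +-assoc x (m · x) (n · x) ⟨
    x + m · x + n · x     ∎

  ∑-cong : ∀ {A : Set} {f g : A → Carrier} → (∀ x → f x ≈ g x) →
           ∀ xs → ∑ (map f xs) ≈ ∑ (map g xs)
  ∑-cong f≈g []       = refl
  ∑-cong f≈g (x ∷ xs) = +-cong (f≈g x) (∑-cong f≈g xs)

  ∑-+ : ∀ {A : Set} (f g : A → Carrier) xs →
        ∑ (map (λ x → f x + g x) xs) ≈ ∑ (map f xs) + ∑ (map g xs)
  ∑-+ f g []       = sym (+-identityˡ 0#)
  ∑-+ f g (x ∷ xs) = begin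
    (f x + g x) + ∑ (map (λ x → f x + g x) xs)    ≈⟨ +-congˡ (∑-+ f g xs) ⟩
    (f x + g x) + (∑ (map f xs) + ∑ (map g xs))   ≈⟨ interchange (f x) (g x) _ _ ⟩
    (f x + ∑ (map f xs)) + (g x + ∑ (map g xs))   ∎

  ∑-zero : ∀ {A : Set} (xs : List A) → ∑ (map (λ _ → 0#) xs) ≈ 0#
  ∑-zero []       = refl
  ∑-zero (_ ∷ xs) = trans (+-identityˡ _) (∑-zero xs)

  module _ {A : Set} (_≟_ : DecidableEquality A) where
    open Multiplicity _≟_

    ∑-indicator : ∀ (f : A → Carrier) x ys →
                  ∑ (map (λ y → ⟦ does (y ≟ x) ⟧ · f y) ys) ≈ multiplicity x ys · f x
    ∑-indicator f x []       = refl
    ∑-indicator f x (y ∷ ys) with y ≟ x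
    ... | yes ≡.refl rewrite dec-true (y ≟ y) ≡.refl =
      +-cong (+-identityʳ (f y)) (∑-indicator f y ys)
    ... | no y≢x rewrite dec-false (x ≟ y) (y≢x ∘ ≡.sym) =
      trans (+-identityˡ _) (∑-indicator f x ys)

    ∑-multiplicity : ∀ (f : A → Carrier) xs ys → All (λ x → multiplicity x ys ≡ 1) xs →
                     ∑ (map (λ y → multiplicity y xs · f y) ys) ≈ ∑ (map f xs)
    ∑-multiplicity f []       ys []                = ∑-zero ys
    ∑-multiplicity f (x ∷ xs) ys (once ∷ onceAll) = begin
      ∑ (map (λ y → (⟦ does (y ≟ x) ⟧ ℕ.+ multiplicity y xs) · f y) ys)
        ≈⟨ ∑-cong (λ y → ·-distribʳ-+ ⟦ does (y ≟ x) ⟧ (multiplicity y xs) (f y)) ys ⟩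
      ∑ (map (λ y → ⟦ does (y ≟ x) ⟧ · f y + multiplicity y xs · f y) ys)
        ≈⟨ ∑-+ (λ y → ⟦ does (y ≟ x) ⟧ · f y) (λ y → multiplicity y xs · f y) ys ⟩
      ∑ (map (λ y → ⟦ does (y ≟ x) ⟧ · f y) ys) + ∑ (map (λ y → multiplicity y xs · f y) ys)
        ≈⟨ +-cong (∑-indicator f x ys) (∑-multiplicity f xs ys onceAll) ⟩
      multiplicity x ys · f x + ∑ (map f xs)
        ≡⟨ ≡.cong (λ n → n · f x + ∑ (map f xs)) once ⟩
      (f x + 0#) + ∑ (map f xs)
        ≈⟨ +-congʳ (+-identityʳ (f x)) ⟩
      f x + ∑ (map f xs) ∎

module Words where
  open import Data.Nat.Base using (_+_; _*_; _≤_; _≡ᵇ_; s≤s)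
  open import Data.Nat.Properties
  open import Data.Nat.ListAction using (sum)
  open import Data.List.Properties using (≡-dec)
  open import Data.List.Relation.Unary.All.Properties using (++⁺; map⁺)
  open import Algebra.Properties.CommutativeSemigroup +-commutativeSemigroup
    using (interchange; x∙yz≈y∙xz; x∙yz≈yx∙z)
  open ≡ using (refl; sym; trans; cong; cong₂; subst; module ≡-Reasoning)

  _≟ʷ_ : DecidableEquality Word
  _≟ʷ_ = ≡-dec _≟_

  open Multiplicity _≟ʷ_

  multiplicity-[]-map-∷ : ∀ i X → multiplicity [] (map (i ∷_) X) ≡ 0
  multiplicity-[]-map-∷ i []      = refl
  multiplicity-[]-map-∷ i (_ ∷ X) = multiplicity-[]-map-∷ i X

  multiplicity-∷-map-∷ : ∀ k w i X →
                         multiplicity (k ∷ w) (map (i ∷_) X) ≡ ⟦ k ≡ᵇ i ⟧ * multiplicity w X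
  multiplicity-∷-map-∷ k w i []      = sym (*-zeroʳ ⟦ k ≡ᵇ i ⟧)
  multiplicity-∷-map-∷ k w i (x ∷ X) = begin
    ⟦ (k ≡ᵇ i) ∧ does (w ≟ʷ x) ⟧ + multiplicity (k ∷ w) (map (i ∷_) X)
      ≡⟨ cong₂ _+_ (⟦∧⟧ (k ≡ᵇ i) (does (w ≟ʷ x))) (multiplicity-∷-map-∷ k w i X) ⟩
    ⟦ k ≡ᵇ i ⟧ * ⟦ does (w ≟ʷ x) ⟧ + ⟦ k ≡ᵇ i ⟧ * multiplicity w X
      ≡⟨ *-distribˡ-+ ⟦ k ≡ᵇ i ⟧ ⟦ does (w ≟ʷ x) ⟧ (multiplicity w X) ⟨
    ⟦ k ≡ᵇ i ⟧ * multiplicity w (x ∷ X) ∎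
    where open ≡-Reasoning

  contraction : ℕ → ℕ → List Word → List Word
  contraction (suc a) (suc b) X = map ((suc a + suc b) ∷_) X
  contraction _       _       X = []

  contractionCoef : ℕ → ℕ → ℕ → ℕ → ℕ
  contractionCoef k (suc a) (suc b) n = ⟦ k ≡ᵇ suc a + suc b ⟧ * n
  contractionCoef k _       _       n = 0

  -- Defs keeps the summands of _∗b_ and Δcoef in private helpers, which only unfold
  -- once the letters (and the Boolean letter comparisons) are known; contraction and
  -- contractionCoef are public copies of the summands for letters b_i, b_j with i, j ≥ 1.
  ∗b-∷∷ : ∀ i u j v → (i ∷ u) ∗b (j ∷ v)
        ≡ map (i ∷_) (u ∗b (j ∷ v)) ++ map (j ∷_) ((i ∷ u) ∗b v) ++ contraction i j (u ∗b v)
  ∗b-∷∷ zero    u j       v = refl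
  ∗b-∷∷ (suc i) u zero    v = refl
  ∗b-∷∷ (suc i) u (suc j) v = refl

  Δcoef-∷∷ : ∀ k w i u j v → Δcoef (k ∷ w) (i ∷ u) (j ∷ v)
           ≡ ⟦ k ≡ᵇ j ⟧ * Δcoef w (i ∷ u) v + ⟦ k ≡ᵇ i ⟧ * Δcoef w u (j ∷ v)
             + contractionCoef k i j (Δcoef w u v)
  Δcoef-∷∷ k w zero u j v with k ≡ᵇ j | k ≡ᵇ zero
  ... | true  | true  = refl
  ... | true  | false = refl
  ... | false | true  = refl
  ... | false | false = refl
  Δcoef-∷∷ k w (suc a) u zero v with k ≡ᵇ zero | k ≡ᵇ suc a
  ... | true  | true  = refl
  ... | true  | false = refl
  ... | false | true  = refl
  ... | false | false = refl
  Δcoef-∷∷ k w (suc a) u (suc b) v with k ≡ᵇ suc b | k ≡ᵇ suc a | k ≡ᵇ (suc a + suc b)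
  ... | true  | true  | true  = refl
  ... | true  | true  | false = refl
  ... | true  | false | true  = refl
  ... | true  | false | false = refl
  ... | false | true  | true  = refl
  ... | false | true  | false = refl
  ... | false | false | true  = refl
  ... | false | false | false = refl

  Δcoef-1⊗ : ∀ w v → Δcoef w [] v ≡ ⟦ does (w ≟ʷ v) ⟧
  Δcoef-1⊗ []      []      = refl
  Δcoef-1⊗ []      (_ ∷ _) = refl
  Δcoef-1⊗ (_ ∷ _) []      = refl
  Δcoef-1⊗ (k ∷ w) (j ∷ v) with k ≡ᵇ j
  ... | true  = trans (+-identityʳ _) (trans (+-identityʳ _) (trans (+-identityʳ _) (Δcoef-1⊗ w v)))
  ... | false = refl

  Δcoef-⊗1 : ∀ w u → Δcoef w u [] ≡ ⟦ does (w ≟ʷ u) ⟧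
  Δcoef-⊗1 []      []            = refl
  Δcoef-⊗1 []      (_ ∷ _)       = refl
  Δcoef-⊗1 (_ ∷ _) []            = refl
  Δcoef-⊗1 (k ∷ w) (zero ∷ u)    with k ≡ᵇ zero
  ... | true  = trans (+-identityʳ _) (trans (+-identityʳ _) (Δcoef-⊗1 w u))
  ... | false = refl
  Δcoef-⊗1 (k ∷ w) (suc i ∷ u)   with k ≡ᵇ suc i
  ... | true  = trans (+-identityʳ _) (trans (+-identityʳ _) (Δcoef-⊗1 w u))
  ... | false = refl

  multiplicity-[]-contraction : ∀ i j X → multiplicity [] (contraction i j X) ≡ 0
  multiplicity-[]-contraction zero    j       X = refl
  multiplicity-[]-contraction (suc i) zero    X = refl
  multiplicity-[]-contraction (suc i) (suc j) X = multiplicity-[]-map-∷ (suc i + suc j) X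

  multiplicity-∷-contraction : ∀ k w i j X →
    multiplicity (k ∷ w) (contraction i j X) ≡ contractionCoef k i j (multiplicity w X)
  multiplicity-∷-contraction k w zero    j       X = refl
  multiplicity-∷-contraction k w (suc i) zero    X = refl
  multiplicity-∷-contraction k w (suc i) (suc j) X = multiplicity-∷-map-∷ k w (suc i + suc j) X

  multiplicity-∗b-∷∷ : ∀ w i u j v → multiplicity w ((i ∷ u) ∗b (j ∷ v))
    ≡ multiplicity w (map (i ∷_) (u ∗b (j ∷ v)))
      + (multiplicity w (map (j ∷_) ((i ∷ u) ∗b v)) + multiplicity w (contraction i j (u ∗b v)))
  multiplicity-∗b-∷∷ w i u j v = begin
    multiplicity w ((i ∷ u) ∗b (j ∷ v))
      ≡⟨ cong (multiplicity w) (∗b-∷∷ i u j v) ⟩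
    multiplicity w (A ++ B ++ C)
      ≡⟨ multiplicity-++ w A (B ++ C) ⟩
    multiplicity w A + multiplicity w (B ++ C)
      ≡⟨ cong (multiplicity w A +_) (multiplicity-++ w B C) ⟩
    multiplicity w A + (multiplicity w B + multiplicity w C) ∎
    where
    open ≡-Reasoning
    A B C : List Word
    A = map (i ∷_) (u ∗b (j ∷ v))
    B = map (j ∷_) ((i ∷ u) ∗b v)
    C = contraction i j (u ∗b v)

  multiplicity-∗b : ∀ w u v → multiplicity w (u ∗b v) ≡ Δcoef w u v
  multiplicity-∗b w       []      v       = trans (+-identityʳ _) (sym (Δcoef-1⊗ w v))
  multiplicity-∗b w       (i ∷ u) []      = trans (+-identityʳ _) (sym (Δcoef-⊗1 w (i ∷ u)))
  multiplicity-∗b []      (i ∷ u) (j ∷ v) = trans (multiplicity-∗b-∷∷ [] i u j v)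
    (cong₂ _+_ (multiplicity-[]-map-∷ i (u ∗b (j ∷ v)))
               (cong₂ _+_ (multiplicity-[]-map-∷ j ((i ∷ u) ∗b v))
                          (multiplicity-[]-contraction i j (u ∗b v))))
  multiplicity-∗b (k ∷ w) (i ∷ u) (j ∷ v) = begin
    multiplicity (k ∷ w) ((i ∷ u) ∗b (j ∷ v))
      ≡⟨ multiplicity-∗b-∷∷ (k ∷ w) i u j v ⟩
    multiplicity (k ∷ w) (map (i ∷_) (u ∗b (j ∷ v)))
      + (multiplicity (k ∷ w) (map (j ∷_) ((i ∷ u) ∗b v)) + multiplicity (k ∷ w) (contraction i j (u ∗b v)))
      ≡⟨ cong₂ _+_ (multiplicity-∷-map-∷ k w i (u ∗b (j ∷ v)))
                   (cong₂ _+_ (multiplicity-∷-map-∷ k w j ((i ∷ u) ∗b v))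
                              (multiplicity-∷-contraction k w i j (u ∗b v))) ⟩
    ⟦ k ≡ᵇ i ⟧ * multiplicity w (u ∗b (j ∷ v))
      + (⟦ k ≡ᵇ j ⟧ * multiplicity w ((i ∷ u) ∗b v) + contractionCoef k i j (multiplicity w (u ∗b v)))
      ≡⟨ cong₂ _+_ (cong (⟦ k ≡ᵇ i ⟧ *_) (multiplicity-∗b w u (j ∷ v)))
                   (cong₂ _+_ (cong (⟦ k ≡ᵇ j ⟧ *_) (multiplicity-∗b w (i ∷ u) v))
                              (cong (contractionCoef k i j) (multiplicity-∗b w u v))) ⟩
    ⟦ k ≡ᵇ i ⟧ * Δcoef w u (j ∷ v) + (⟦ k ≡ᵇ j ⟧ * Δcoef w (i ∷ u) v + contractionCoef k i j (Δcoef w u v))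
      ≡⟨ x∙yz≈yx∙z (⟦ k ≡ᵇ i ⟧ * Δcoef w u (j ∷ v)) (⟦ k ≡ᵇ j ⟧ * Δcoef w (i ∷ u) v)
                   (contractionCoef k i j (Δcoef w u v)) ⟩
    ⟦ k ≡ᵇ j ⟧ * Δcoef w (i ∷ u) v + ⟦ k ≡ᵇ i ⟧ * Δcoef w u (j ∷ v) + contractionCoef k i j (Δcoef w u v)
      ≡⟨ Δcoef-∷∷ k w i u j v ⟨
    Δcoef (k ∷ w) (i ∷ u) (j ∷ v) ∎
    where open ≡-Reasoning

  All-contraction : ∀ {P : Word → Set} i j {X} →
                    All (P ∘ ((i + j) ∷_)) X → All P (contraction i j X)
  All-contraction zero    j       _ = []
  All-contraction (suc i) zero    _ = []
  All-contraction (suc i) (suc j) p = map⁺ p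

  All-∗b-∷∷ : ∀ {P : Word → Set} i u j v →
              All (P ∘ (i ∷_)) (u ∗b (j ∷ v)) → All (P ∘ (j ∷_)) ((i ∷ u) ∗b v) →
              All (P ∘ ((i + j) ∷_)) (u ∗b v) → All P ((i ∷ u) ∗b (j ∷ v))
  All-∗b-∷∷ {P} i u j v p q r =
    subst (All P) (sym (∗b-∷∷ i u j v)) (++⁺ (map⁺ p) (++⁺ (map⁺ q) (All-contraction i j r)))

  ∗b-wt : ∀ u v → All (λ x → wt x ≡ wt u + wt v) (u ∗b v)
  ∗b-wt []      v       = refl ∷ []
  ∗b-wt (i ∷ u) []      = sym (+-identityʳ (wt (i ∷ u))) ∷ []
  ∗b-wt (i ∷ u) (j ∷ v) = All-∗b-∷∷ i u j v
    (All.map (λ e → trans (cong (i +_) e) (sym (+-assoc i (wt u) (j + wt v)))) (∗b-wt u (j ∷ v)))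
    (All.map (λ e → trans (cong (j +_) e) (x∙yz≈y∙xz j (i + wt u) (wt v))) (∗b-wt (i ∷ u) v))
    (All.map (λ e → trans (cong (i + j +_) e) (interchange i j (wt u) (wt v))) (∗b-wt u v))

  ∗b-length : ∀ u v → All (λ x → length x ≤ length u + length v) (u ∗b v)
  ∗b-length []      v       = ≤-refl ∷ []
  ∗b-length (i ∷ u) []      = ≤-reflexive (sym (+-identityʳ (length (i ∷ u)))) ∷ []
  ∗b-length (i ∷ u) (j ∷ v) = All-∗b-∷∷ i u j v
    (All.map s≤s (∗b-length u (j ∷ v)))
    (All.map (λ le → s≤s (≤-trans le (≤-reflexive (sym (+-suc (length u) (length v))))))
             (∗b-length (i ∷ u) v))
    (All.map (λ le → s≤s (≤-trans le (+-monoʳ-≤ (length u) (n≤1+n (length v))))) (∗b-length u v))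

  multiplicity-wordsOfLength : ∀ {N} x L → All (_≤ N) x →
                               multiplicity x (wordsOfLength L N) ≡ ⟦ length x ≡ᵇ L ⟧
  multiplicity-wordsOfLength     []      zero    _ = refl
  multiplicity-wordsOfLength {N} []      (suc L) _ =
    trans (multiplicity-concatMap [] (λ i → map (i ∷_) (wordsOfLength L N)) (upTo (suc N)))
          (sum-map-zero (All.universal (λ i → multiplicity-[]-map-∷ i (wordsOfLength L N))
                                       (upTo (suc N))))
  multiplicity-wordsOfLength     (k ∷ x) zero    _ = refl
  multiplicity-wordsOfLength {N} (k ∷ x) (suc L) (k≤N ∷ x≤N) = begin
    multiplicity (k ∷ x) (concatMap (λ i → map (i ∷_) (wordsOfLength L N)) (upTo (suc N)))
      ≡⟨ multiplicity-concatMap (k ∷ x) (λ i → map (i ∷_) (wordsOfLength L N)) (upTo (suc N)) ⟩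
    sum (map (λ i → multiplicity (k ∷ x) (map (i ∷_) (wordsOfLength L N))) (upTo (suc N)))
      ≡⟨ sum-upTo-single _ (s≤s k≤N) other-letters ⟩
    multiplicity (k ∷ x) (map (k ∷_) (wordsOfLength L N))
      ≡⟨ multiplicity-∷-map-∷ k x k (wordsOfLength L N) ⟩
    ⟦ k ≡ᵇ k ⟧ * multiplicity x (wordsOfLength L N)
      ≡⟨ cong₂ _*_ (cong ⟦_⟧ (dec-true (k ≟ k) refl)) (multiplicity-wordsOfLength x L x≤N) ⟩
    1 * ⟦ length x ≡ᵇ L ⟧
      ≡⟨ *-identityˡ ⟦ length x ≡ᵇ L ⟧ ⟩
    ⟦ length x ≡ᵇ L ⟧ ∎
    where
    open ≡-Reasoning
    other-letters : ∀ i → i ≢ k → multiplicity (k ∷ x) (map (i ∷_) (wordsOfLength L N)) ≡ 0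
    other-letters i i≢k =
      trans (multiplicity-∷-map-∷ k x i (wordsOfLength L N))
            (cong (λ b → ⟦ b ⟧ * multiplicity x (wordsOfLength L N)) (dec-false (k ≟ i) (i≢k ∘ sym)))

  multiplicity-wordsUpTo : ∀ {L N} x → length x ≤ L → All (_≤ N) x →
                           multiplicity x (wordsUpTo L N) ≡ 1
  multiplicity-wordsUpTo {L} {N} x |x|≤L x≤N = begin
    multiplicity x (concatMap (λ l → wordsOfLength l N) (upTo (suc L)))
      ≡⟨ multiplicity-concatMap x (λ l → wordsOfLength l N) (upTo (suc L)) ⟩
    sum (map (λ l → multiplicity x (wordsOfLength l N)) (upTo (suc L)))
      ≡⟨ sum-upTo-single _ (s≤s |x|≤L) other-lengths ⟩
    multiplicity x (wordsOfLength (length x) N)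
      ≡⟨ multiplicity-wordsOfLength x (length x) x≤N ⟩
    ⟦ length x ≡ᵇ length x ⟧
      ≡⟨ cong ⟦_⟧ (dec-true (length x ≟ length x) refl) ⟩
    1 ∎
    where
    open ≡-Reasoning
    other-lengths : ∀ l → l ≢ length x → multiplicity x (wordsOfLength l N) ≡ 0
    other-lengths l l≢|x| = trans (multiplicity-wordsOfLength x l x≤N)
                                  (cong ⟦_⟧ (dec-false (length x ≟ l) (l≢|x| ∘ sym)))

  supportΔ-∗b : ∀ u v → All (λ x → multiplicity x (supportΔ u v) ≡ 1) (u ∗b v)
  supportΔ-∗b u v = All.zipWith once (∗b-length u v , ∗b-wt u v)
    where
    once : ∀ {x} → length x ≤ length u + length v × wt x ≡ wt u + wt v →
           multiplicity x (supportΔ u v) ≡ 1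
    once {x} (|x|≤ , wt≡) =
      multiplicity-wordsUpTo x |x|≤ (subst (λ N → All (_≤ N) x) wt≡ (All-≤-sum x))

open Words using (_≟ʷ_; multiplicity-∗b; supportΔ-∗b)
open Multiplicity _≟ʷ_ using (multiplicity)

module _ {c ℓ : Level} (R : QAlgebra c ℓ) where
  open QAlgebra R using (_≈_; setoid; sym; trans)
  open FiniteSums R using (_·_; ∑; ∑-multiplicity)
  open import Relation.Binary.Reasoning.Setoid setoid

  ΔbCoeff-∗b : ∀ (Φ : Series R) u v → ΔbCoeff R Φ u v ≈ ∑ (map Φ (u ∗b v))
  ΔbCoeff-∗b Φ u v = begin
    ∑ (map (λ w → Δcoef w u v · Φ w) (supportΔ u v))
      ≡⟨ ≡.cong ∑ (map-cong (λ w → ≡.cong (_· Φ w) (≡.sym (multiplicity-∗b w u v)))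
                            (supportΔ u v)) ⟩
    ∑ (map (λ w → multiplicity w (u ∗b v) · Φ w) (supportΔ u v))
      ≈⟨ ∑-multiplicity _≟ʷ_ Φ (u ∗b v) (supportΔ u v) (supportΔ-∗b u v) ⟩
    ∑ (map Φ (u ∗b v)) ∎

  IsBM⇔IsHomGf : ∀ Φ → IsBM R Φ ⇔ IsHomGf R Φ
  IsBM⇔IsHomGf Φ = mk⇔ toHom toBM
    where
    toHom : IsBM R Φ → IsHomGf R Φ
    toHom bm = record
      { unit    = unit
      ; mult    = λ u v → trans (sym (ΔbCoeff-∗b Φ u v)) (grouplike u v)
      ; b₀-zero = b₀-zero
      ; τ-inv   = λ w w∈B⁰ → sym (τ-inv w w∈B⁰)
      }
      where open IsBM bm
    toBM : IsHomGf R Φ → IsBM R Φ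
    toBM hom = record
      { unit      = unit
      ; b₀-zero   = b₀-zero
      ; grouplike = λ u v → trans (ΔbCoeff-∗b Φ u v) (mult u v)
      ; τ-inv     = λ w w∈B⁰ → sym (τ-inv w w∈B⁰)
      }
      where open IsHomGf hom

  IsBMλμν⇔IsHomGfλμν : ∀ λ' μ ν Φ → IsBMλμν R λ' μ ν Φ ⇔ IsHomGfλμν R λ' μ ν Φ
  IsBMλμν⇔IsHomGfλμν λ' μ ν Φ = mk⇔ toHom toBM
    where
    open Equivalence (IsBM⇔IsHomGf Φ)
    toHom : IsBMλμν R λ' μ ν Φ → IsHomGfλμν R λ' μ ν Φ
    toHom bm = record { isHom = to isBM ; b₂ = b₂ ; b₄ = b₄ ; b₆ = b₆ }
      where open IsBMλμν bm
    toBM : IsHomGfλμν R λ' μ ν Φ → IsBMλμν R λ' μ ν Φ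
    toBM hom = record { isBM = from isHom ; b₂ = b₂ ; b₄ = b₄ ; b₆ = b₆ }
      where open IsHomGfλμν hom

theorem6p2 : ∀ {c ℓ : Level} (R : QAlgebra c ℓ) →
    ((Φ : Word → QAlgebra.Carrier R) → IsBM R Φ ⇔ IsHomGf R Φ)
    × ((λ' μ ν : QAlgebra.Carrier R) (Φ : Word → QAlgebra.Carrier R) →
         IsBMλμν R λ' μ ν Φ ⇔ IsHomGfλμν R λ' μ ν Φ)
theorem6p2 R = IsBM⇔IsHomGf R , IsBMλμν⇔IsHomGfλμν R
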